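{- Let $D=(E,\mathcal F)$ be a vf-safe delta-matroid, and let $S\subseteq E$. Then there exists $A\subseteq S$, with an ordering $e_1,\ldots,e_k$ of the elements of $A$, such that $$\omega(D^{\ast\times\ast|A})=\max_{B\subseteq S}\omega(D^{\ast\times\ast|B}),$$ and the sequence $$\omega(D),\ \omega(D^{\ast\times\ast|\{e_1\}}),\ \omega(D^{\ast\times\ast|\{e_1,e_2\}}),\ \ldots,\ \omega(D^{\ast\times\ast|A})$$ is non-decreasing.
   Context: A set system is a pair $D=(E,\mathcal F)$ with $E$ a finite set and $\mathcal F\subseteq 2^E$; the members of $\mathcal F$ are the feasible sets. $D$ is proper if $\mathcal F\neq\emptyset$. A delta-matroid is a proper set system such that for all $X,Y\in\mathcal F$ and every $u\in X\triangle Y$ there exists $v\in X\triangle Y$ (possibly $v=u$) with $X\triangle\{u,v\}\in\mathcal F$, where $\triangle$ is symmetric difference. For proper $D$, $r(D_{\max})$ and $r(D_{\min})$ denote the largest and smallest cardinality of a feasible set, and the width is $\omega(D)=r(D_{\max})-r(D_{\min})$. Twist: for $A\subseteq E$, $D^{\ast|A}=(E,\{F\triangle A\mid F\in\mathcal F\})$. Loop complementation: for $e\in E$, $D^{\times|e}=(E,\mathcal F')$ with $\mathcal F'=\mathcal F\,\triangle\,\{F\cup\{e\}\mid F\in\mathcal F,\ e\notin F\}$. Loop complementations on distinct elements commute, and for $A\subseteq E$, $D^{\times|A}$ is obtained by applying loop complementation to every element of $A$. These operations preserve properness. Words are read left to right: $D^{\ast\times\ast|A}=((D^{\ast|A})^{\times|A})^{\ast|A}$.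 A delta-matroid $D$ is vf-safe if every set system obtained from $D$ by an arbitrary finite sequence of twists and loop complementations (on elements or subsets of $E$) is again a delta-matroid. -}

module Defs where

open import Data.Bool.Base using (Bool; T; _xor_)
open import Data.Bool.Properties using (T?) renaming (_≟_ to _≟ᵇ_)
open import Data.Fin.Base using (Fin)
open import Data.Fin.Subset
open import Data.Fin.Subset.Properties using (anySubset?; _∈?_; _⊆?_)
open import Data.List.Base using (List; []; _∷_; _++_; [_]; map; filter; foldl; allFin; module Inits)
open import Data.List.Extrema.Nat using (max; min)
open import Data.List.Relation.Unary.Unique.Propositional using (Unique)
open import Data.Nat.Base using (ℕ; zero; suc; _∸_)
open import Data.Product.Base using (_×_; ∃-syntax)
open import Data.Vec.Base using (zipWith) renaming ([] to []ᵛ; _∷_ to _∷ᵛ_)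
open import Data.Vec.Properties using (≡-dec)
open import Relation.Binary.Definitions using (DecidableEquality)
open import Relation.Binary.PropositionalEquality.Core using (_≡_)
open import Relation.Nullary.Decidable.Core using (⌊_⌋; _×-dec_; ¬?)

private
  variable
    n : ℕ

infixl 6 _△_
_△_ : Subset n → Subset n → Subset n
_△_ = zipWith _xor_

_≟ˢ_ : DecidableEquality (Subset n)
_≟ˢ_ = ≡-dec _≟ᵇ_

allSubsets : ∀ n → List (Subset n)
allSubsets zero    = [ []ᵛ ]
allSubsets (suc n) = map (outside ∷ᵛ_) (allSubsets n) ++ map (inside ∷ᵛ_) (allSubsets n)

-- The ground set is Fin n; the family of feasible sets is given by its
-- characteristic function, so an arbitrary member of 2^(2^E) is allowed.
SetSystem : ℕ → Set
SetSystem n = Subset n → Bool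

infix 4 _∈ᶠ_
_∈ᶠ_ : Subset n → SetSystem n → Set
F ∈ᶠ D = T (D F)

Proper : SetSystem n → Set
Proper D = ∃[ F ] F ∈ᶠ D

record IsDeltaMatroid (D : SetSystem n) : Set where
  field
    proper   : Proper D
    exchange : ∀ {X Y} → X ∈ᶠ D → Y ∈ᶠ D → ∀ {u} → u ∈ X △ Y →
               ∃[ v ] v ∈ X △ Y × X △ (⁅ u ⁆ ∪ ⁅ v ⁆) ∈ᶠ D

feasibleSizes : SetSystem n → List ℕ
feasibleSizes D = map ∣_∣ (filter (λ F → T? (D F)) (allSubsets _))

-- The defaults 0 and n are neutral, since every size lies between them;
-- they are the value only when D is not proper.
r-max r-min : SetSystem n → ℕ
r-max     D = max 0 (feasibleSizes D)
r-min {n} D = min n (feasibleSizes D)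

ω : SetSystem n → ℕ
ω D = r-max D ∸ r-min D

infixl 7 _*∣_ _×∣ₑ_ _×∣_ _*×*∣_

-- { F △ A | F ∈ D }
_*∣_ : SetSystem n → Subset n → SetSystem n
(D *∣ A) G = ⌊ anySubset? (λ F → T? (D F) ×-dec G ≟ˢ (F △ A)) ⌋

-- { F ∪ {e} | F ∈ D , e ∉ F }
addTo : Fin n → SetSystem n → SetSystem n
addTo e D G = ⌊ anySubset? (λ F → T? (D F) ×-dec ¬? (e ∈? F) ×-dec G ≟ˢ (F ∪ ⁅ e ⁆)) ⌋

-- xor of characteristic functions is the symmetric difference of families.
_×∣ₑ_ : SetSystem n → Fin n → SetSystem n
(D ×∣ₑ e) G = D G xor addTo e D G

-- Loop complementations on distinct elements commute, so processing the
-- elements of A in increasing order is only a choice of representative.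
_×∣_ : SetSystem n → Subset n → SetSystem n
D ×∣ A = foldl _×∣ₑ_ D (filter (_∈? A) (allFin _))

_*×*∣_ : SetSystem n → Subset n → SetSystem n
D *×*∣ A = D *∣ A ×∣ A *∣ A

-- A twist on an element e is the twist on ⁅ e ⁆.
data Operation (n : ℕ) : Set where
  twist      : Subset n → Operation n
  loopCompl  : Subset n → Operation n
  loopComplₑ : Fin n → Operation n

apply : SetSystem n → Operation n → SetSystem n
apply D (twist A)      = D *∣ A
apply D (loopCompl A)  = D ×∣ A
apply D (loopComplₑ e) = D ×∣ₑ e

VfSafe : SetSystem n → Set
VfSafe D = ∀ ops → IsDeltaMatroid (foldl apply D ops)

-- The default f ⊥ is one of the values, since ⊥ ⊆ S.
max⊆ : Subset n → (Subset n → ℕ) → ℕ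
max⊆ S f = max (f ⊥) (map f (filter (_⊆? S) (allSubsets _)))

setOf : List (Fin n) → Subset n
setOf es = ⋃ (map ⁅_⁆ es)

IsOrderingOf : List (Fin n) → Subset n → Set
IsOrderingOf es A = Unique es × setOf es ≡ A

-- Inits.tail (e₁ ∷ … ∷ eₖ ∷ []) lists the nonempty prefixes by length, so this is
-- ω(D), ω(D *×*∣ {e₁}), …, ω(D *×*∣ {e₁,…,eₖ}).
widths : SetSystem n → List (Fin n) → List ℕ
widths D es = ω D ∷ map (λ p → ω (D *×*∣ setOf p)) (Inits.tail es)

{-# OPTIONS --safe #-}
module Submission where

-- A one-element step D ↦ D *×*∣ {e} keeps r-max. It lowers r-min, by one, when e lies in
-- some minimum feasible set F: then F ∖ {e} becomes feasible, no minimum feasible set of the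
-- new system contains e, and every element that belonged to no minimum feasible set keeps
-- this property. Hence one pass through S, applying the step exactly to the elements
-- that lie in a minimum feasible set at their turn, has non-decreasing widths and ends
-- in a system D_A whose minimum feasible sets all avoid S. This is optimal: for B ⊆ S each
-- X feasible in D_B is contained in some Y ⊆ X ∪ S feasible in D_A, and in the delta-matroid
-- D_A the set Y contains a minimum feasible set F, so F ⊆ X and r-min D_A ≤ ∣ X ∣.

open import Defs
open import Algebra.Bundles using (CommutativeRing)
import Algebra.Properties.CommutativeSemigroup
open import Data.Bool.Base using (true; false; T; not; _∧_; _xor_)
open import Data.Bool.Properties using (T?; xor-∧-commutativeRing; xor-assoc; xor-comm; xor-same; xor-identityʳ)
open import Data.Empty using (⊥-elim)
open import Data.Fin.Base using (Fin; zero; suc)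
open import Data.Fin.Properties using () renaming (_≟_ to _≟ᶠ_)
open import Data.Fin.Subset
open import Data.Fin.Subset.Properties
  using ( _∈?_; _⊆?_; anySubset?; ∣p∣≤n; p⊆q⇒∣p∣≤∣q∣; p⊂q⇒∣p∣<∣q∣; ∉⊥; x∈⁅x⁆; x∈⁅y⁆⇒x≡y
        ; x∉p⇒x∈∁p; x∈∁p⇒x∉p; x∈p∩q⁺; x∈p∩q⁻; x∈p∪q⁺; x∈p∪q⁻; ∪-idem; ∪-identityʳ; ⊆-refl)
open import Data.List.Base using (List; []; _∷_; map; filter; foldl; allFin; module Inits)
open import Data.List.Extrema.Nat
  using (argmin; argmin-all; f[argmin]≤f[xs]; min≤v⁺; v≤min⁺; max≤v⁺; v≤max⁺)
open import Data.List.Membership.Propositional using () renaming (_∈_ to _∈ˡ_)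
open import Data.List.Membership.Propositional.Properties
  using (∈-filter⁺; ∈-filter⁻; ∈-allFin; ∈-map⁺; ∈-++⁺ˡ; ∈-++⁺ʳ)
open import Data.List.Properties using (map-∘; map-cong-local)
open import Data.List.Relation.Binary.Permutation.Propositional using (_↭_; prep; swap)
  renaming (refl to ↭-refl; trans to ↭-trans)
open import Data.List.Relation.Binary.BagAndSetEquality using (∼bag⇒↭)
open import Data.List.Membership.Propositional.Properties.WithK using (unique∧set⇒bag)
open import Data.List.Relation.Binary.Subset.Propositional using () renaming (_⊆_ to _⊆ˡ_)
open import Data.List.Relation.Unary.All as All using (All; []; _∷_)
open import Data.List.Relation.Unary.All.Properties as All using (anti-mono)
open import Data.List.Relation.Unary.AllPairs using ([]; _∷_)
open import Data.List.Relation.Unary.Any as Any using (here; there)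
open import Data.List.Relation.Unary.Linked using (Linked; [-]; _∷_)
open import Data.List.Relation.Unary.Unique.Propositional using (Unique)
open import Data.List.Relation.Unary.Unique.Propositional.Properties using (allFin⁺; filter⁺)
open import Data.Nat.Base using (ℕ; zero; suc; _≤_; _<_; z≤n; s≤s)
open import Data.Nat.Properties
  using ( ≤-refl; ≤-reflexive; ≤-trans; ≤-antisym; <⇒≤; <⇒≱; ∸-mono; n≤1+n
        ; _≤?_; module ≤-Reasoning)
open import Data.Product.Base using (_×_; _,_; proj₁; proj₂; ∃-syntax)
open import Data.Sum.Base using (_⊎_; inj₁; inj₂)
open import Data.Vec.Base using (lookup) renaming ([] to []ᵛ; _∷_ to _∷ᵛ_; here to hereᵛ; there to thereᵛ)
open import Data.Vec.Properties
  using (lookup-zipWith; []=⇒lookup; lookup⇒[]=; zipWith-assoc; zipWith-comm; zipWith-identityʳ)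
open import Function.Base using (_∘_)
open import Function.Bundles using (mk⇔)
open import Relation.Binary.PropositionalEquality
open import Relation.Nullary using (¬_; yes; no; contradiction)
open import Relation.Nullary.Decidable using (isYes≗does; does-⇔; _×-dec_)
open import Relation.Unary using (Decidable)

open Algebra.Properties.CommutativeSemigroup
  (CommutativeRing.+-commutativeSemigroup xor-∧-commutativeRing) using (interchange)

private
  variable
    n : ℕ
    e f x : Fin n
    A B F G S X : Subset n
    D D′ : SetSystem n

-- Symmetric difference and toggling a single element.

△-⊥ : (G : Subset n) → G △ ⊥ ≡ G
△-⊥ = zipWith-identityʳ xor-identityʳ

△-assoc : (F G H : Subset n) → F △ G △ H ≡ F △ (G △ H)
△-assoc = zipWith-assoc xor-assoc

△-swap : (G A B : Subset n) → G △ A △ B ≡ G △ B △ A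
△-swap G A B = trans (△-assoc G A B)
  (trans (cong (G △_) (zipWith-comm xor-comm A B)) (sym (△-assoc G B A)))

△-same : (A : Subset n) → A △ A ≡ ⊥
△-same []ᵛ      = refl
△-same (a ∷ᵛ A) = cong₂ _∷ᵛ_ (xor-same a) (△-same A)

△-cancel : (G A : Subset n) → G △ A △ A ≡ G
△-cancel G A = trans (△-assoc G A A) (trans (cong (G △_) (△-same A)) (△-⊥ G))

lookup-⁅⁆-≡ : (e : Fin n) → lookup ⁅ e ⁆ e ≡ true
lookup-⁅⁆-≡ e = []=⇒lookup (x∈⁅x⁆ e)

∉⇒lookup : e ∉ G → lookup G e ≡ false
∉⇒lookup {e = e} {G = G} e∉G with lookup G e in eq
... | true  = contradiction (lookup⇒[]= e G eq) e∉G
... | false = refl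

lookup⇒∉ : lookup G e ≡ false → e ∉ G
lookup⇒∉ eq e∈G with () ← trans (sym ([]=⇒lookup e∈G)) eq

lookup-toggle-≢ : e ≢ f → (G : Subset n) → lookup (G △ ⁅ f ⁆) e ≡ lookup G e
lookup-toggle-≢ {e = e} {f} e≢f G = trans (lookup-zipWith _xor_ e G ⁅ f ⁆)
  (trans (cong (lookup G e xor_) (∉⇒lookup (e≢f ∘ x∈⁅y⁆⇒x≡y f))) (xor-identityʳ _))

lookup-toggle-≡ : (e : Fin n) (G : Subset n) → lookup (G △ ⁅ e ⁆) e ≡ not (lookup G e)
lookup-toggle-≡ e G rewrite lookup-zipWith _xor_ e G ⁅ e ⁆ | lookup-⁅⁆-≡ e = xor-comm (lookup G e) true

∈-toggle-≢⁺ : x ≢ e → x ∈ G → x ∈ G △ ⁅ e ⁆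
∈-toggle-≢⁺ {G = G} x≢e x∈G = lookup⇒[]= _ _ (trans (lookup-toggle-≢ x≢e G) ([]=⇒lookup x∈G))

∈-toggle-≢⁻ : x ≢ e → x ∈ G △ ⁅ e ⁆ → x ∈ G
∈-toggle-≢⁻ {G = G} x≢e x∈ = lookup⇒[]= _ _ (trans (sym (lookup-toggle-≢ x≢e G)) ([]=⇒lookup x∈))

∈-toggle⁺ : e ∉ G → e ∈ G △ ⁅ e ⁆
∈-toggle⁺ {e = e} {G = G} e∉G = lookup⇒[]= e _ (trans (lookup-toggle-≡ e G) (cong not (∉⇒lookup e∉G)))

∉-toggle⁺ : e ∈ G → e ∉ G △ ⁅ e ⁆
∉-toggle⁺ {e = e} {G = G} e∈G = lookup⇒∉ (trans (lookup-toggle-≡ e G) (cong not ([]=⇒lookup e∈G)))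

∣∣-insert : e ∉ G → ∣ G △ ⁅ e ⁆ ∣ ≡ suc ∣ G ∣
∣∣-insert {e = zero}  {inside  ∷ᵛ G} e∉G = contradiction hereᵛ e∉G
∣∣-insert {e = zero}  {outside ∷ᵛ G} e∉G = cong (suc ∘ ∣_∣) (△-⊥ G)
∣∣-insert {e = suc e} {inside  ∷ᵛ G} e∉G = cong suc (∣∣-insert (e∉G ∘ thereᵛ))
∣∣-insert {e = suc e} {outside ∷ᵛ G} e∉G = ∣∣-insert (e∉G ∘ thereᵛ)

∣∣-delete : e ∈ G → suc ∣ G △ ⁅ e ⁆ ∣ ≡ ∣ G ∣
∣∣-delete {e = e} {G = G} e∈G =
  trans (sym (∣∣-insert (∉-toggle⁺ e∈G))) (cong ∣_∣ (△-cancel G ⁅ e ⁆))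

∪⁅⁆≡△ : e ∉ G → G ∪ ⁅ e ⁆ ≡ G △ ⁅ e ⁆
∪⁅⁆≡△ {e = zero}  {inside  ∷ᵛ G} e∉G = contradiction hereᵛ e∉G
∪⁅⁆≡△ {e = zero}  {outside ∷ᵛ G} e∉G = cong (inside ∷ᵛ_) (trans (∪-identityʳ G) (sym (△-⊥ G)))
∪⁅⁆≡△ {e = suc e} {inside  ∷ᵛ G} e∉G = cong (inside ∷ᵛ_) (∪⁅⁆≡△ (e∉G ∘ thereᵛ))
∪⁅⁆≡△ {e = suc e} {outside ∷ᵛ G} e∉G = cong (outside ∷ᵛ_) (∪⁅⁆≡△ (e∉G ∘ thereᵛ))

△-pair : e ≢ f → (G : Subset n) → G △ (⁅ e ⁆ ∪ ⁅ f ⁆) ≡ G △ ⁅ e ⁆ △ ⁅ f ⁆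
△-pair {e = e} {f} e≢f G =
  trans (cong (G △_) (∪⁅⁆≡△ (λ f∈ → e≢f (sym (x∈⁅y⁆⇒x≡y e f∈))))) (sym (△-assoc G ⁅ e ⁆ ⁅ f ⁆))

-- One-element steps as pointwise flips.

-- Pointwise, flip e D is D *×*∣ ⁅ e ⁆; for e ∉ G the set G △ ⁅ e ⁆ is G ∪ {e}.
flip : Fin n → SetSystem n → SetSystem n
flip e D G = D G xor (not (lookup G e) ∧ D (G △ ⁅ e ⁆))

flips : SetSystem n → List (Fin n) → SetSystem n
flips = foldl (λ D e → flip e D)

flip-∈ : (D : SetSystem n) → e ∈ G → flip e D G ≡ D G
flip-∈ D e∈G rewrite []=⇒lookup e∈G = xor-identityʳ _

flip-∉ : (D : SetSystem n) → e ∉ G → flip e D G ≡ D G xor D (G △ ⁅ e ⁆)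
flip-∉ D e∉G rewrite ∉⇒lookup e∉G = refl

flip-cong : (e : Fin n) → D ≗ D′ → flip e D ≗ flip e D′
flip-cong e D≗D′ G rewrite D≗D′ G | D≗D′ (G △ ⁅ e ⁆) = refl

flips-cong : (es : List (Fin n)) → D ≗ D′ → flips D es ≗ flips D′ es
flips-cong []       D≗D′ = D≗D′
flips-cong (e ∷ es) D≗D′ = flips-cong es (flip-cong e D≗D′)

flip-comm : (e f : Fin n) (D : SetSystem n) → flip e (flip f D) ≗ flip f (flip e D)
flip-comm e f D G with e ≟ᶠ f
... | yes refl = refl
... | no e≢f
  rewrite lookup-toggle-≢ e≢f G | lookup-toggle-≢ (e≢f ∘ sym) G | △-swap G ⁅ f ⁆ ⁅ e ⁆
  with lookup G e | lookup G f
... | true  | true  = refl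
... | true  | false = trans (xor-identityʳ _) (sym (cong₂ _xor_ (xor-identityʳ (D G)) (xor-identityʳ _)))
... | false | true  = trans (cong₂ _xor_ (xor-identityʳ (D G)) (xor-identityʳ _)) (sym (xor-identityʳ _))
-- With e and f both outside G, each side is the parity of the feasible sets among G, G ∪ {e}, G ∪
-- {f} and G ∪ {e, f}.
... | false | false = interchange (D G) (D (G △ ⁅ f ⁆)) (D (G △ ⁅ e ⁆)) _

-- `*×*∣` processes a set in increasing order, whereas the list in the theorem has its own order;
-- commuting flips reconcile the two.
flips-↭ : ∀ {es fs} (D : SetSystem n) → es ↭ fs → flips D es ≗ flips D fs
flips-↭ D ↭-refl                G = refl
flips-↭ D (prep e p)            G = flips-↭ (flip e D) p G
flips-↭ D (swap {ys = ys} e f p) G =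
  trans (flips-↭ (flip f (flip e D)) p G) (flips-cong ys (flip-comm f e D) G)
flips-↭ D (↭-trans p q)         G = trans (flips-↭ D p G) (flips-↭ D q G)

-- Twists and loop complementations expressed by flips.

*∣-apply : (D : SetSystem n) (A G : Subset n) → (D *∣ A) G ≡ D (G △ A)
*∣-apply D A G = trans (isYes≗does _) (does-⇔ (mk⇔ to from) (anySubset? _) (T? (D (G △ A))))
  where
  to : ∃[ F ] F ∈ᶠ D × G ≡ F △ A → T (D (G △ A))
  to (F , F∈D , refl) = subst (T ∘ D) (sym (△-cancel F A)) F∈D
  from : T (D (G △ A)) → ∃[ F ] F ∈ᶠ D × G ≡ F △ A
  from t = G △ A , t , sym (△-cancel G A)

addTo-apply : (e : Fin n) (D : SetSystem n) (G : Subset n) →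
              addTo e D G ≡ lookup G e ∧ D (G △ ⁅ e ⁆)
addTo-apply e D G = trans (isYes≗does _) (does-⇔ (mk⇔ to from) (anySubset? _) (T? _))
  where
  to : ∃[ F ] F ∈ᶠ D × e ∉ F × G ≡ F ∪ ⁅ e ⁆ → T (lookup G e ∧ D (G △ ⁅ e ⁆))
  to (F , F∈D , e∉F , refl)
    rewrite ∪⁅⁆≡△ e∉F | △-cancel F ⁅ e ⁆ | []=⇒lookup (∈-toggle⁺ e∉F) = F∈D
  from : T (lookup G e ∧ D (G △ ⁅ e ⁆)) → ∃[ F ] F ∈ᶠ D × e ∉ F × G ≡ F ∪ ⁅ e ⁆
  from t with lookup G e in eq
  ... | true = G △ ⁅ e ⁆ , t , e∉ , sym (trans (∪⁅⁆≡△ e∉) (△-cancel G ⁅ e ⁆))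
    where
    e∉ : e ∉ G △ ⁅ e ⁆
    e∉ = ∉-toggle⁺ (lookup⇒[]= e G eq)

-- Since e ∈ A, the twist by A exchanges e ∈ G with e ∉ G △ A. This turns the condition of
-- `addTo-apply` into that of `flip`; the other elements of A only relabel the sets.
×∣ₑ-conjugate : e ∈ A → D′ ≗ (λ G → D (G △ A)) → (D′ ×∣ₑ e) ≗ (λ G → flip e D (G △ A))
×∣ₑ-conjugate {e = e} {A} {D′} {D} e∈A D′≗ G
  rewrite addTo-apply e D′ G | D′≗ G | D′≗ (G △ ⁅ e ⁆) | △-swap G ⁅ e ⁆ A
        | lookup-zipWith _xor_ e G A | []=⇒lookup e∈A with lookup G e
... | true  = refl
... | false = refl

foldl-×∣ₑ-conjugate : ∀ {es} → All (_∈ A) es → D′ ≗ (λ G → D (G △ A)) →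
                      foldl _×∣ₑ_ D′ es ≗ (λ G → flips D es (G △ A))
foldl-×∣ₑ-conjugate []           D′≗ = D′≗
foldl-×∣ₑ-conjugate {D = D} (e∈A ∷ es∈A) D′≗ =
  foldl-×∣ₑ-conjugate es∈A (×∣ₑ-conjugate {D = D} e∈A D′≗)

elements : Subset n → List (Fin n)
elements A = filter (_∈? A) (allFin _)

elements-unique : (A : Subset n) → Unique (elements A)
elements-unique A = filter⁺ (_∈? A) (allFin⁺ _)

∈-elements⁺ : x ∈ A → x ∈ˡ elements A
∈-elements⁺ {A = A} x∈A = ∈-filter⁺ (_∈? A) (∈-allFin _) x∈A

∈-elements⁻ : x ∈ˡ elements A → x ∈ A
∈-elements⁻ {A = A} x∈ = proj₂ (∈-filter⁻ (_∈? A) {xs = allFin _} x∈)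

*×*-flips-elements : (D : SetSystem n) (A : Subset n) → (D *×*∣ A) ≗ flips D (elements A)
*×*-flips-elements D A G = begin
  (D *∣ A ×∣ A *∣ A) G              ≡⟨ *∣-apply (D *∣ A ×∣ A) A G ⟩
  (D *∣ A ×∣ A) (G △ A)             ≡⟨ foldl-×∣ₑ-conjugate {D = D} (All.tabulate ∈-elements⁻)
                                         (*∣-apply D A) (G △ A) ⟩
  flips D (elements A) (G △ A △ A)  ≡⟨ cong (flips D (elements A)) (△-cancel G A) ⟩
  flips D (elements A) G            ∎
  where open ≡-Reasoning

∈-setOf⁺ : ∀ {es} → x ∈ˡ es → x ∈ setOf es
∈-setOf⁺ {es = e ∷ es} (here refl) = x∈p∪q⁺ (inj₁ (x∈⁅x⁆ e))
∈-setOf⁺ {es = e ∷ es} (there x∈)  = x∈p∪q⁺ {p = ⁅ e ⁆} (inj₂ (∈-setOf⁺ x∈))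

∈-setOf⁻ : ∀ es → x ∈ setOf es → x ∈ˡ es
∈-setOf⁻ []       x∈ = contradiction x∈ ∉⊥
∈-setOf⁻ (e ∷ es) x∈ with x∈p∪q⁻ ⁅ e ⁆ (setOf es) x∈
... | inj₁ x∈e  = here (x∈⁅y⁆⇒x≡y e x∈e)
... | inj₂ x∈es = there (∈-setOf⁻ es x∈es)

-- Uniqueness matters: `flip e` is an involution, so a repeated entry would cancel, whereas `setOf`
-- ignores repetition. Two repetition-free lists with the same members are permutations of each
-- other.
*×*-flips : ∀ {es} (D : SetSystem n) → Unique es → (D *×*∣ setOf es) ≗ flips D es
*×*-flips {es = es} D unique G = trans (*×*-flips-elements D (setOf es) G)
  (flips-↭ D (∼bag⇒↭ (unique∧set⇒bag (elements-unique (setOf es)) unique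
    (mk⇔ (∈-setOf⁻ es ∘ ∈-elements⁻) (∈-elements⁺ ∘ ∈-setOf⁺)))) G)

-- Extremal sizes of feasible sets and the width.

∈-allSubsets : (F : Subset n) → F ∈ˡ allSubsets n
∈-allSubsets []ᵛ            = here refl
∈-allSubsets (outside ∷ᵛ F) = ∈-++⁺ˡ (∈-map⁺ _ (∈-allSubsets F))
∈-allSubsets {suc n} (inside ∷ᵛ F) = ∈-++⁺ʳ (map (outside ∷ᵛ_) (allSubsets n)) (∈-map⁺ _ (∈-allSubsets F))

feasibleSizes⁺ : F ∈ᶠ D → ∣ F ∣ ∈ˡ feasibleSizes D
feasibleSizes⁺ {F = F} {D} F∈D = ∈-map⁺ ∣_∣ (∈-filter⁺ (λ F → T? (D F)) (∈-allSubsets F) F∈D)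

feasibleSizes-all : {P : ℕ → Set} → (∀ {F} → F ∈ᶠ D → P ∣ F ∣) → All P (feasibleSizes D)
feasibleSizes-all {D = D} p = All.map⁺ (All.tabulate λ F∈ →
  p (proj₂ (∈-filter⁻ (λ F → T? (D F)) {xs = allSubsets _} F∈)))

≤r-max : F ∈ᶠ D → ∣ F ∣ ≤ r-max D
≤r-max {D = D} F∈D = v≤max⁺ 0 (feasibleSizes D) (inj₂ (Any.map ≤-reflexive (feasibleSizes⁺ {D = D} F∈D)))

r-max≤ : ∀ {m} → (∀ {F} → F ∈ᶠ D → ∣ F ∣ ≤ m) → r-max D ≤ m
r-max≤ {D = D} bound = max≤v⁺ z≤n (feasibleSizes-all {D = D} bound)

r-min≤ : F ∈ᶠ D → r-min D ≤ ∣ F ∣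
r-min≤ {n} {D = D} F∈D =
  min≤v⁺ n (feasibleSizes D) (inj₂ (Any.map (≤-reflexive ∘ sym) (feasibleSizes⁺ {D = D} F∈D)))

-- The hypothesis `m ≤ n` covers the default value in `r-min`.
≤r-min : ∀ {n} {D : SetSystem n} {m} → m ≤ n → (∀ {F} → F ∈ᶠ D → m ≤ ∣ F ∣) → m ≤ r-min D
≤r-min {D = D} m≤n bound = v≤min⁺ m≤n (feasibleSizes-all {D = D} bound)

r-min≤n : (D : SetSystem n) → r-min D ≤ n
r-min≤n {n} D = min≤v⁺ n (feasibleSizes D) (inj₁ ≤-refl)

r-max-mono : ∀ {n} {D D′ : SetSystem n} → (∀ {X} → X ∈ᶠ D → ∃[ Y ] Y ∈ᶠ D′ × ∣ X ∣ ≤ ∣ Y ∣) → r-max D ≤ r-max D′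
r-max-mono {D = D} {D′} larger = r-max≤ {D = D} λ X∈D →
  let Y , Y∈D′ , X≤Y = larger X∈D in ≤-trans X≤Y (≤r-max {D = D′} Y∈D′)

r-min-mono : ∀ {n} {D D′ : SetSystem n} → (∀ {X} → X ∈ᶠ D → ∃[ Y ] Y ∈ᶠ D′ × ∣ Y ∣ ≤ ∣ X ∣) → r-min D′ ≤ r-min D
r-min-mono {D = D} {D′} smaller = ≤r-min {D = D} (r-min≤n D′) λ X∈D →
  let Y , Y∈D′ , Y≤X = smaller X∈D in ≤-trans (r-min≤ {D = D′} Y∈D′) Y≤X

ω-mono : ∀ {n} {D D′ : SetSystem n} → r-max D ≤ r-max D′ → r-min D′ ≤ r-min D → ω D ≤ ω D′
ω-mono = ∸-mono

ω-cong : ∀ {n} {D D′ : SetSystem n} → D ≗ D′ → ω D ≡ ω D′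
ω-cong {D = D} {D′} D≗D′ = ≤-antisym (half D≗D′) (half (sym ∘ D≗D′))
  where
  half : ∀ {D D′ : SetSystem _} → D ≗ D′ → ω D ≤ ω D′
  half {D} {D′} D≗D′ = ω-mono {D = D} {D′}
    (r-max-mono {D = D} {D′} λ {X} X∈D → X , subst T (D≗D′ X) X∈D , ≤-refl)
    (r-min-mono {D = D} {D′} λ {X} X∈D → X , subst T (D≗D′ X) X∈D , ≤-refl)

-- Enlarging feasible sets within S.

infix 4 _⊑[_]_
-- That is, X ⊆ Y ⊆ X ∪ S. The first inclusion serves to compare `r-max`; the second serves to
-- compare `r-min` once the minimum feasible sets of `D′` avoid S.
_⊑[_]_ : SetSystem n → Subset n → SetSystem n → Set
D ⊑[ S ] D′ = ∀ {X} → X ∈ᶠ D → ∃[ Y ] Y ∈ᶠ D′ × X ⊆ Y × (∀ {x} → x ∈ Y → x ∉ S → x ∈ X)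

⊑-refl : D ⊑[ S ] D
⊑-refl {X = X} X∈D = X , X∈D , ⊆-refl , λ x∈X _ → x∈X

⊑-trans : ∀ {D₁ D₂ D₃ : SetSystem n} → D₁ ⊑[ S ] D₂ → D₂ ⊑[ S ] D₃ → D₁ ⊑[ S ] D₃
⊑-trans D₁⊑D₂ D₂⊑D₃ X∈D₁ =
  let Y , Y∈D₂ , X⊆Y , Y⊆X∪S = D₁⊑D₂ X∈D₁
      Z , Z∈D₃ , Y⊆Z , Z⊆Y∪S = D₂⊑D₃ Y∈D₂
  in  Z , Z∈D₃ , Y⊆Z ∘ X⊆Y , λ x∈Z x∉S → Y⊆X∪S (Z⊆Y∪S x∈Z x∉S) x∉S

insert-⊆ : e ∉ X → X ⊆ X △ ⁅ e ⁆
insert-⊆ e∉X x∈X = ∈-toggle-≢⁺ (λ { refl → e∉X x∈X }) x∈X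

insert-outside : e ∈ S → x ∈ X △ ⁅ e ⁆ → x ∉ S → x ∈ X
insert-outside e∈S x∈ x∉S = ∈-toggle-≢⁻ (λ { refl → x∉S e∈S }) x∈

xor-T : ∀ a b → T (a xor b) → ¬ T a → T b
xor-T true  b     t ¬a = ⊥-elim (¬a _)
xor-T false b     t ¬a = t

T-xorˡ : ∀ a b → T a → ¬ T b → T (a xor b)
T-xorˡ true true  a ¬b = ¬b _
T-xorˡ true false a ¬b = _

T-xorʳ : ∀ a b → ¬ T a → T b → T (a xor b)
T-xorʳ true  b ¬a t = ⊥-elim (¬a _)
T-xorʳ false b ¬a t = t

-- A set X that is feasible only after the flip lacks e, and X ∪ {e} is feasible in D.
flip-⊑ : e ∈ S → flip e D ⊑[ S ] D
flip-⊑ {e = e} {D = D} e∈S {X} X∈ with T? (D X)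
... | yes X∈D = X , X∈D , ⊆-refl , λ x∈X _ → x∈X
... | no  X∉D with e ∈? X
...   | yes e∈X = contradiction (subst T (flip-∈ D e∈X) X∈) X∉D
...   | no  e∉X = X △ ⁅ e ⁆ , xor-T (D X) _ (subst T (flip-∉ D e∉X) X∈) X∉D
                , insert-⊆ e∉X , insert-outside e∈S

-- The flip destroys X only if e ∉ X and X ∪ {e} is feasible too; the latter contains e and
-- survives.
⊑-flip : e ∈ S → D ⊑[ S ] flip e D
⊑-flip {e = e} {D = D} e∈S {X} X∈D with e ∈? X
... | yes e∈X = X , subst T (sym (flip-∈ D e∈X)) X∈D , ⊆-refl , λ x∈X _ → x∈X
... | no  e∉X with T? (D (X △ ⁅ e ⁆))
...   | yes Xe∈D = X △ ⁅ e ⁆ , subst T (sym (flip-∈ D (∈-toggle⁺ e∉X))) Xe∈D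
                 , insert-⊆ e∉X , insert-outside e∈S
...   | no  Xe∉D = X , subst T (sym (flip-∉ D e∉X)) (T-xorˡ (D X) _ X∈D Xe∉D)
                 , ⊆-refl , λ x∈X _ → x∈X

flips-⊑ : ∀ {es} → All (_∈ S) es → flips D es ⊑[ S ] D
flips-⊑ {D = D} []           = ⊑-refl {D = D}
flips-⊑ {D = D} {es = e ∷ es} (e∈S ∷ es∈S) =
  ⊑-trans {D₁ = flips D (e ∷ es)} {D₃ = D} (flips-⊑ es∈S) (flip-⊑ {D = D} e∈S)

⊑-flips : ∀ {es} → All (_∈ S) es → D ⊑[ S ] flips D es
⊑-flips {D = D} []           = ⊑-refl {D = D}
⊑-flips {D = D} {es = e ∷ es} (e∈S ∷ es∈S) =
  ⊑-trans {D₁ = D} {D₃ = flips D (e ∷ es)} (⊑-flip {D = D} e∈S) (⊑-flips es∈S)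

⊑⇒r-max≤ : ∀ {n} {S : Subset n} {D D′ : SetSystem n} → D ⊑[ S ] D′ → r-max D ≤ r-max D′
⊑⇒r-max≤ {D = D} {D′} D⊑D′ = r-max-mono {D = D} {D′} λ X∈D →
  let Y , Y∈D′ , X⊆Y , _ = D⊑D′ X∈D in Y , Y∈D′ , p⊆q⇒∣p∣≤∣q∣ X⊆Y

-- Minimum feasible sets and the effect of a flip on them.

-- By `r-min≤` the inequality is an equality for feasible F.
Minimum : SetSystem n → Subset n → Set
Minimum D F = F ∈ᶠ D × ∣ F ∣ ≤ r-min D

minimum? : (D : SetSystem n) → Decidable (Minimum D)
minimum? D F = T? (D F) ×-dec ∣ F ∣ ≤? r-min D

-- For a delta-matroid, these are the loops of the matroid whose bases are the minimum feasible
-- sets.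
Avoided : SetSystem n → Fin n → Set
Avoided D x = ∀ {F} → Minimum D F → x ∉ F

module _ (D : SetSystem n) (e : Fin n) (F : Subset n) (min : Minimum D F) (e∈F : e ∈ F) where

  private
    ∣F-e∣<r-min : ∣ F △ ⁅ e ⁆ ∣ < r-min D
    ∣F-e∣<r-min = subst (_≤ r-min D) (sym (∣∣-delete e∈F)) (proj₂ min)

    F-e∈flip : F △ ⁅ e ⁆ ∈ᶠ flip e D
    -- F ∖ {e} is too small to be in D, and toggling e back gives F, which is in D; so exactly one
    -- term of the xor holds.
    F-e∈flip = subst T (sym (flip-∉ D (∉-toggle⁺ e∈F)))
      (T-xorʳ (D (F △ ⁅ e ⁆)) _ (λ F-e∈D → <⇒≱ ∣F-e∣<r-min (r-min≤ {D = D} F-e∈D))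
        (subst (T ∘ D) (sym (△-cancel F ⁅ e ⁆)) (proj₁ min)))

  r-min-flip< : r-min (flip e D) < r-min D
  r-min-flip< = ≤-trans (s≤s (r-min≤ {D = flip e D} F-e∈flip)) ∣F-e∣<r-min

  ω-flip-≤ : ω D ≤ ω (flip e D)
  -- `⊑-flip` asks for a set containing e; F itself serves.
  ω-flip-≤ = ω-mono {D = D} {flip e D} (⊑⇒r-max≤ {D = D} (⊑-flip {D = D} e∈F)) (<⇒≤ r-min-flip<)

  -- A minimum member G of flip e D is too small to be in D, so e ∉ G and G ∪ {e}
  -- is a minimum member of D.
  minimum-flip : Minimum (flip e D) G → e ∉ G × Minimum D (G △ ⁅ e ⁆)
  minimum-flip {G = G} (G∈ , G≤) = e∉G
    , xor-T (D G) _ (subst T (flip-∉ D e∉G) G∈) G∉D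
    , subst (_≤ r-min D) (sym (∣∣-insert e∉G)) ∣G∣<r-min
    where
    ∣G∣<r-min : ∣ G ∣ < r-min D
    ∣G∣<r-min = ≤-trans (s≤s G≤) r-min-flip<
    G∉D : ¬ G ∈ᶠ D
    G∉D G∈D = <⇒≱ ∣G∣<r-min (r-min≤ {D = D} G∈D)
    e∉G : e ∉ G
    e∉G e∈G = G∉D (subst T (flip-∈ D e∈G) G∈)

  flip-avoids : Avoided (flip e D) e
  flip-avoids minG = proj₁ (minimum-flip minG)

  -- A minimum set of `flip e D` is a minimum set of D with e removed, so no further element enters.
  flip-preserves-avoided : Avoided D x → Avoided (flip e D) x
  flip-preserves-avoided avoided minG x∈G =
    let e∉G , minGe = minimum-flip minG in avoided minGe (insert-⊆ e∉G x∈G)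

-- The greedy pass.

flipWidths : SetSystem n → List (Fin n) → List ℕ
flipWidths D es = ω D ∷ map (λ p → ω (flips D p)) (Inits.tail es)

-- The flips of D along `e ∷ p` are those of `flip e D` along `p`, so the sequence restarts at
-- `flip e D`, as the induction in `greedy` requires.
flipWidths-∷ : (D : SetSystem n) (e : Fin n) (es : List (Fin n)) →
               flipWidths D (e ∷ es) ≡ ω D ∷ flipWidths (flip e D) es
flipWidths-∷ D e es = cong (λ ws → ω D ∷ ω (flip e D) ∷ ws) (sym (map-∘ (Inits.tail es)))

-- The alternative `Avoided D x` strengthens the induction: an element already passed is no longer
-- in `xs`, yet must stay avoided through the remaining flips.
greedy : (D : SetSystem n) (xs : List (Fin n)) → Unique xs →
         ∃[ es ] Unique es × es ⊆ˡ xs × Linked _≤_ (flipWidths D es)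
               × (∀ {x} → x ∈ˡ xs ⊎ Avoided D x → Avoided (flips D es) x)
greedy D []       [] = [] , [] , (λ ()) , [-] , λ { (inj₁ ()) ; (inj₂ avoided) → avoided }
greedy D (e ∷ xs) (e∉xs ∷ xs!) with anySubset? (λ F → minimum? D F ×-dec e ∈? F)
... | no none =
  let es , es! , es⊆xs , linked , avoids = greedy D xs xs!
  in  es , es! , there ∘ es⊆xs , linked
    , λ { (inj₁ (here refl)) → avoids (inj₂ λ minF e∈F → none (_ , minF , e∈F))
        ; (inj₁ (there x∈))  → avoids (inj₁ x∈)
        ; (inj₂ avoided)     → avoids (inj₂ avoided) }
... | yes (F , minF , e∈F) =
  let es , es! , es⊆xs , linked , avoids = greedy (flip e D) xs xs!
  in  e ∷ es , anti-mono es⊆xs e∉xs ∷ es!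
    , (λ { (here eq) → here eq ; (there x∈) → there (es⊆xs x∈) })
    , subst (Linked _≤_) (sym (flipWidths-∷ D e es)) (ω-flip-≤ D e F minF e∈F ∷ linked)
    , λ { (inj₁ (here refl)) → avoids (inj₂ (flip-avoids D e F minF e∈F))
        ; (inj₁ (there x∈))  → avoids (inj₁ x∈)
        ; (inj₂ avoided)     → avoids (inj₂ (flip-preserves-avoided D e F minF e∈F avoided)) }

-- Minimum feasible sets inside a given feasible set.

minimiser : {P : Subset n → Set} → Decidable P → (f : Subset n → ℕ) → P X →
            ∃[ F ] P F × (∀ {G} → P G → f F ≤ f G)
minimiser {n} {X} P? f PX = argmin f X candidates
  , argmin-all f PX (All.tabulate λ F∈ → proj₂ (∈-filter⁻ P? {xs = allSubsets n} F∈))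
  , λ {G} PG → All.lookup (f[argmin]≤f[xs] X candidates) (∈-filter⁺ P? (∈-allSubsets G) PG)
  where
  candidates = filter P? (allSubsets n)

minimum-exists : X ∈ᶠ D → ∃[ F ] Minimum D F
minimum-exists {D = D} X∈D =
  let F , F∈D , least = minimiser (λ G → T? (D G)) ∣_∣ X∈D
  in  F , F∈D , ≤r-min {D = D} (∣p∣≤n F) least

-- Among the minimum feasible sets, F has the fewest elements outside X. If some u ∈ F lay outside
-- X, exchange at u would give either a smaller feasible set or a minimum one with fewer elements
-- outside X.
minimum-⊆ : IsDeltaMatroid D → X ∈ᶠ D → ∃[ F ] Minimum D F × F ⊆ X
minimum-⊆ {D = D} {X} isDM X∈D =
  let F₀ , minF₀ = minimum-exists {D = D} X∈D
      F , minF , least = minimiser (minimum? D) (λ G → ∣ G ∩ ∁ X ∣) minF₀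
  in  F , minF , contained F minF least
  where
  contained : ∀ F → Minimum D F → (∀ {G} → Minimum D G → ∣ F ∩ ∁ X ∣ ≤ ∣ G ∩ ∁ X ∣) → F ⊆ X
  contained F (F∈D , F≤) least {u} u∈F with u ∈? X
  ... | yes u∈X = u∈X
  ... | no  u∉X
    with v , v∈F△X , F′∈D ← IsDeltaMatroid.exchange isDM F∈D X∈D {u} (lookup⇒[]= u _
           (trans (lookup-zipWith _xor_ u F X) (cong₂ _xor_ ([]=⇒lookup u∈F) (∉⇒lookup u∉X))))
    with u ≟ᶠ v
  -- For v = u the exchange merely deletes u, leaving a feasible set below the minimum size.
  ... | yes refl = contradiction (≤-trans F≤ (r-min≤ {D = D} F-u∈D)) (<⇒≱ (≤-reflexive (∣∣-delete u∈F)))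
    where
    F-u∈D : F △ ⁅ u ⁆ ∈ᶠ D
    F-u∈D = subst (λ P → F △ P ∈ᶠ D) (∪-idem ⁅ u ⁆) F′∈D
  ... | no  u≢v with v ∈? F
  ...   | yes v∈F = contradiction (≤-trans F≤ (r-min≤ {D = D} F′∈D)) (<⇒≱ smaller)
    where
    smaller : ∣ F △ (⁅ u ⁆ ∪ ⁅ v ⁆) ∣ < ∣ F ∣
    smaller = begin
      suc ∣ F △ (⁅ u ⁆ ∪ ⁅ v ⁆) ∣  ≡⟨ cong (suc ∘ ∣_∣) (△-pair u≢v F) ⟩
      suc ∣ F △ ⁅ u ⁆ △ ⁅ v ⁆ ∣    ≡⟨ ∣∣-delete (∈-toggle-≢⁺ (u≢v ∘ sym) v∈F) ⟩
      ∣ F △ ⁅ u ⁆ ∣                ≤⟨ n≤1+n _ ⟩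
      suc ∣ F △ ⁅ u ⁆ ∣            ≡⟨ ∣∣-delete u∈F ⟩
      ∣ F ∣                        ∎
      where open ≤-Reasoning
  -- Now v ∈ X ∖ F, so u is traded for v: the size is unchanged and one element fewer lies outside
  -- X.
  ...   | no  v∉F = contradiction (least (F′′∈D , ≤-trans (≤-reflexive ∣F′∣≡∣F∣) F≤))
                      (<⇒≱ (p⊂q⇒∣p∣<∣q∣ (closer , u , x∈p∩q⁺ (u∈F , x∉p⇒x∈∁p u∉X) , u∉)))
    where
    F′ : Subset _
    F′ = F △ ⁅ u ⁆ △ ⁅ v ⁆
    F′′∈D : F′ ∈ᶠ D
    F′′∈D = subst (_∈ᶠ D) (△-pair u≢v F) F′∈D
    ∣F′∣≡∣F∣ : ∣ F′ ∣ ≡ ∣ F ∣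
    ∣F′∣≡∣F∣ = trans (∣∣-insert (v∉F ∘ ∈-toggle-≢⁻ (u≢v ∘ sym))) (∣∣-delete u∈F)
    v∈X : v ∈ X
    v∈X = lookup⇒[]= v X (trans (sym (trans (lookup-zipWith _xor_ v F X)
            (cong (_xor lookup X v) (∉⇒lookup v∉F)))) ([]=⇒lookup v∈F△X))
    u∉ : u ∉ F′ ∩ ∁ X
    u∉ u∈ = ∉-toggle⁺ u∈F (∈-toggle-≢⁻ u≢v (proj₁ (x∈p∩q⁻ F′ (∁ X) u∈)))
    closer : F′ ∩ ∁ X ⊆ F ∩ ∁ X
    closer {x} x∈ with x∈F′ , x∈∁X ← x∈p∩q⁻ F′ (∁ X) x∈ with x ≟ᶠ u | x ≟ᶠ v
    ... | yes refl | _        = x∈p∩q⁺ (u∈F , x∈∁X)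
    ... | no  x≢u  | yes refl = contradiction v∈X (x∈∁p⇒x∉p x∈∁X)
    ... | no  x≢u  | no  x≢v  = x∈p∩q⁺ (∈-toggle-≢⁻ x≢u (∈-toggle-≢⁻ x≢v x∈F′) , x∈∁X)

-- Optimality when the minimum feasible sets avoid S.

-- ⊑ preserves the part of a member outside S, which is where all minimum members of D live.
avoided⇒r-min≤ : ∀ {n} {S : Subset n} {D D′ : SetSystem n} → IsDeltaMatroid D →
                 (∀ {x} → x ∈ S → Avoided D x) → D′ ⊑[ S ] D → r-min D ≤ r-min D′
avoided⇒r-min≤ {S = S} {D} {D′} isDM avoided D′⊑D = r-min-mono {D = D′} {D} λ {X} X∈D′ →
  let Y , Y∈D , _ , Y⊆X∪S = D′⊑D X∈D′
      F , minF , F⊆Y      = minimum-⊆ isDM Y∈D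
  in  F , proj₁ minF , p⊆q⇒∣p∣≤∣q∣ λ {x} x∈F → Y⊆X∪S (F⊆Y x∈F) λ x∈S → avoided x∈S minF x∈F

-- Transfer from flips to the defined operations, and conclusion.

isDeltaMatroid-cong : ∀ {n} {D D′ : SetSystem n} → D ≗ D′ → IsDeltaMatroid D → IsDeltaMatroid D′
isDeltaMatroid-cong D≗D′ isDM = record
  { proper   = let F , F∈D = proper in F , to F F∈D
  ; exchange = λ {X} {Y} X∈ Y∈ u∈ →
      let v , v∈ , Z∈ = exchange (from X X∈) (from Y Y∈) u∈ in v , v∈ , to _ Z∈
  }
  where
  open IsDeltaMatroid isDM
  to   = λ F → subst T (D≗D′ F)
  from = λ F → subst T (sym (D≗D′ F))

-- Lets `*×*-flips` be applied to every prefix in `widths`.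
inits-unique : ∀ {es : List (Fin n)} → Unique es → All Unique (Inits.tail es)
inits-unique []           = []
-- `All.inits⁺` also covers the empty prefix, which `All.tail` drops.
inits-unique (e∉ ∷ es!) = ([] ∷ []) ∷ All.map⁺ (All.zipWith (λ (p , q) → p ∷ q)
  (All.tail (All.inits⁺ e∉) , inits-unique es!))

widths-flips : ∀ {es} (D : SetSystem n) → Unique es → widths D es ≡ flipWidths D es
widths-flips D es! = cong (ω D ∷_) (map-cong-local (All.map (ω-cong ∘ *×*-flips D) (inits-unique es!)))

max⊆-≡ : (f : Subset n → ℕ) → A ⊆ S → (∀ B → B ⊆ S → f B ≤ f A) → f A ≡ max⊆ S f
max⊆-≡ {A = A} {S} f A⊆S greatest = ≤-antisym
  (v≤max⁺ _ _ (inj₂ (Any.map ≤-reflexive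
    (∈-map⁺ f (∈-filter⁺ (_⊆? S) (∈-allSubsets A) A⊆S)))))
  -- The default `f ⊥` of the maximum is bounded through ⊥ ⊆ S.
  (max≤v⁺ (greatest _ (λ x∈⊥ → contradiction x∈⊥ ∉⊥)) (All.map⁺ (All.tabulate λ B∈ →
    greatest _ (proj₂ (∈-filter⁻ (_⊆? S) {xs = allSubsets _} B∈)))))

theorem4p11 : ∀ (n : ℕ) (D : SetSystem n) → IsDeltaMatroid D → VfSafe D →
    ∀ (S : Subset n) →
    ∃[ A ] A ⊆ S
    × (∃[ es ] IsOrderingOf es A
    × ω (D *×*∣ A) ≡ max⊆ S (λ B → ω (D *×*∣ B))
    × Linked _≤_ (widths D es))
theorem4p11 n D _ vfSafe S
  with es , es! , es⊆S , linked , avoids ← greedy D (elements S) (elements-unique S)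
  = setOf es , A⊆S , es , (es! , refl) , max⊆-≡ (λ B → ω (D *×*∣ B)) A⊆S optimal
  , subst (Linked _≤_) (sym (widths-flips D es!)) linked
  where
  A⊆S : setOf es ⊆ S
  A⊆S x∈A = ∈-elements⁻ (es⊆S (∈-setOf⁻ es x∈A))
  isDM : IsDeltaMatroid (flips D es)
  -- Applying these three operations in turn computes to `D *×*∣ setOf es`.
  isDM = isDeltaMatroid-cong (*×*-flips D es!) (vfSafe (twist (setOf es) ∷ loopCompl (setOf es) ∷ twist (setOf es) ∷ []))
  optimal : ∀ B → B ⊆ S → ω (D *×*∣ B) ≤ ω (D *×*∣ setOf es)
  optimal B B⊆S = begin
    ω (D *×*∣ B)              ≡⟨ ω-cong (*×*-flips-elements D B) ⟩
    ω (flips D (elements B))  ≤⟨ ω-mono {D = flips D (elements B)} {flips D es}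
                                   (⊑⇒r-max≤ {D = flips D (elements B)} B⊑A)
                                   (avoided⇒r-min≤ isDM (λ x∈S → avoids (inj₁ (∈-elements⁺ x∈S))) B⊑A) ⟩
    ω (flips D es)            ≡⟨ ω-cong (*×*-flips D es!) ⟨
    ω (D *×*∣ setOf es)              ∎
    where
    open ≤-Reasoning
    -- The comparison passes through D: flips within S can be traversed in either direction of `⊑`,
    -- so B and A need not be related to each other.
    B⊑A : flips D (elements B) ⊑[ S ] flips D es
    B⊑A = ⊑-trans {D₂ = D} {flips D es}
      (flips-⊑ {D = D} (All.tabulate (B⊆S ∘ ∈-elements⁻)))
      (⊑-flips {D = D} (All.tabulate (∈-elements⁻ ∘ es⊆S)))
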